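{- Let $p$ be a prime, $q=p^f$ with $f\ge1$, let $k\mid q-1$, and let $A_k=\{x^k:x\in\mathbb{F}_q^\times\}\le\mathbb{F}_q^\times$ have order $t=(q-1)/k>1$. Suppose that $p^e\equiv r\pmod t$ for integers $e\ge1$ and $r$, where $r\neq1$ and $p\nmid r$. Put $$M(r)=\begin{cases} r-1,& r\ge2,\\ 2|r|,& r\le-1.\end{cases}$$ Then $|(A_k-a)\cap(A_k-b)|\le M(r)$ for all $a,b\in\mathbb{F}_q$ with $a\ne b$. Every decomposition $A_k=S+T$ with $S,T\subseteq\mathbb{F}_q$ and $|S|,|T|\ge2$ therefore satisfies $|S|\le M(r)$ and $|T|\le M(r)$. Consequently, if $t>M(r)^2$, then $A_k$ is additively irreducible.
   Context: $A-a=\{x-a:x\in A\}$ and $S+T=\{s+u:s\in S,\ u\in T\}$, both in the additive group of $\mathbb{F}_q$. A set $A\subseteq\mathbb{F}_q$ is additively irreducible if there are no sets $S,T$ with $|S|,|T|\ge2$ and $A=S+T$. -}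

module Defs where

open import Algebra.Apartness.Bundles using (HeytingField; HeytingCommutativeRing)
open import Algebra.Bundles using (CommutativeRing)
open import Data.Fin using (Fin)
import Data.Fin.Properties as Fin
import Data.Fin.Subset as Sub
open Sub using (Subset; ∣_∣)
import Data.Fin.Subset.Properties as Sub
open import Data.Integer using (ℤ; +_; -[1+_])
import Data.Integer as ℤ
import Data.Integer.Divisibility as ℤ
open import Data.Nat using (ℕ; suc; _∸_; _≤_)
import Data.Nat as ℕ
open import Data.Product using (∃; ∃-syntax; _×_; _,_)
open import Data.Vec using (tabulate)
open import Function using (_∘_)
open import Function.Bundles using (Inverse)
open import Level using (_⊔_) renaming (suc to lsuc)
import Relation.Binary as B
open import Relation.Binary.PropositionalEquality using (_≡_; setoid; subst)
open import Relation.Nullary using (¬_; Dec; does; map′; ¬?; _×-dec_)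
open import Relation.Unary using (Pred; Decidable)

-- In a Heyting field the apartness x # y holds exactly when x - y is invertible,
-- so tightness says that a non-invertible element is 0.  The enumeration makes
-- _≈_ decidable, hence every x ≉ 0# is invertible, as in a classical field.
record FiniteField c ℓ₁ ℓ₂ (q : ℕ) : Set (lsuc (c ⊔ ℓ₁ ⊔ ℓ₂)) where
  field
    heytingField : HeytingField c ℓ₁ ℓ₂

  open HeytingField heytingField using (heytingCommutativeRing)

  commutativeRing : CommutativeRing c ℓ₁
  commutativeRing = HeytingCommutativeRing.commutativeRing heytingCommutativeRing

  field
    enumeration : Inverse (setoid (Fin q)) (CommutativeRing.setoid commutativeRing)

  open CommutativeRing commutativeRing public
  open import Algebra.Properties.Semiring.Exp semiring public using (_^_; ^-congˡ)
  open Inverse enumeration public using () renaming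
    ( to to element; from to index; from-cong to index-cong
    ; strictlyInverseˡ to element-index )
  open Inverse enumeration using (to-cong)

  infix 4 _≟_

  _≟_ : B.Decidable _≈_
  x ≟ y = map′
    (λ i≡j → trans (sym (element-index x)) (trans (to-cong i≡j) (element-index y)))
    index-cong
    (index x Fin.≟ index y)

  ∃? : ∀ {p} {P : Pred Carrier p} → P B.Respects _≈_ → Decidable P → Dec (∃ P)
  ∃? resp P? = map′
    (λ (i , Px) → element i , Px)
    (λ (x , Px) → index x , resp (sym (element-index x)) Px)
    (Fin.any? (P? ∘ element))

-- A set of field elements is encoded as the subset of Fin q of their indices, so that
-- _≡_, ∣_∣ and _∩_ of Data.Fin.Subset are extensional equality, size and intersection.
module FieldSubsets {c ℓ₁ ℓ₂ q} (F : FiniteField c ℓ₁ ℓ₂ q) where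
  open FiniteField F

  infix 4 _∈_ _∈?_

  _∈_ : Carrier → Subset q → Set
  x ∈ S = index x Sub.∈ S

  _∈?_ : ∀ x S → Dec (x ∈ S)
  x ∈? S = index x Sub.∈? S

  ∈-resp : ∀ S → (_∈ S) B.Respects _≈_
  ∈-resp S x≈y = subst (Sub._∈ S) (index-cong x≈y)

  comprehension : ∀ {p} (P : Pred Carrier p) → Decidable P → Subset q
  comprehension P P? = tabulate (λ i → does (P? (element i)))

  -- the translate S - a = { x - a : x ∈ S }
  infixl 8 _⊝_
  _⊝_ : Subset q → Carrier → Subset q
  S ⊝ a = comprehension
    (λ y → ∃[ x ] (x ∈ S × y ≈ x - a))
    (λ y → ∃?
      (λ x≈x′ (x∈S , eq) → ∈-resp S x≈x′ x∈S , trans eq (+-congʳ x≈x′))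
      (λ x → (x ∈? S) ×-dec (y ≟ x - a)))

  infixl 8 _⊕_
  _⊕_ : Subset q → Subset q → Subset q
  S ⊕ T = comprehension
    (λ z → ∃[ s ] (s ∈ S × ∃[ u ] (u ∈ T × z ≈ s + u)))
    (λ z → ∃?
      (λ s≈s′ (s∈S , u , u∈T , eq) →
        ∈-resp S s≈s′ s∈S , u , u∈T , trans eq (+-congʳ s≈s′))
      (λ s → (s ∈? S) ×-dec ∃?
        (λ u≈u′ (u∈T , eq) → ∈-resp T u≈u′ u∈T , trans eq (+-congˡ u≈u′))
        (λ u → (u ∈? T) ×-dec (z ≟ s + u))))

  nonzeroPowers : ℕ → Subset q
  nonzeroPowers k = comprehension
    (λ y → ∃[ x ] (x ≉ 0# × y ≈ x ^ k))
    (λ y → ∃?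
      (λ x≈x′ (x≉0 , eq) →
        (λ x′≈0 → x≉0 (trans x≈x′ x′≈0)) , trans eq (^-congˡ k x≈x′))
      (λ x → ¬? (x ≟ 0#) ×-dec (y ≟ x ^ k)))

  AdditivelyIrreducible : Subset q → Set
  AdditivelyIrreducible A =
    ¬ (∃[ S ] ∃[ T ] (2 ≤ ∣ S ∣ × 2 ≤ ∣ T ∣ × A ≡ S ⊕ T))

infix 4 _≡_[mod_]
_≡_[mod_] : ℤ → ℤ → ℕ → Set
a ≡ b [mod t ] = + t ℤ.∣ a ℤ.- b

-- r - 1 for r ≥ 2 and 2|r| for r ≤ -1; the values at 0 and 1 are junk.
M : ℤ → ℕ
M (+ n)    = n ∸ 1
M -[1+ n ] = 2 ℕ.* suc n

{-# OPTIONS --safe #-}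

module Submission where

-- Since p ^ e ≡ r (mod t), every x ∈ A satisfies x ^ p^e = x ^ r, while x ↦ x ^ p^e is additive.
-- Hence if x and x + d both lie in A, with d ≠ 0, then (x + d) ^ r = x ^ r + d ^ p^e.  Once
-- denominators are cleared, this is a nonzero polynomial equation in x of degree M(r).
-- If A = S + T, then S lies in (A - a) ∩ (A - b) for any distinct a, b ∈ T, and likewise for T.

open import Algebra.Bundles using (CommutativeRing)
open import Algebra.Apartness.Bundles using (module HeytingField)
import Algebra.Properties.CommutativeMonoid.Sum as MonoidSum
import Algebra.Properties.CommutativeSemiring.Binomial as Binomial
import Algebra.Properties.CommutativeSemiring.Exp as Exp
import Algebra.Properties.Ring as RingProperties
import Algebra.Properties.Semiring.Mult as Mult
import Algebra.Solver.Ring.NaturalCoefficients.Default as SemiringSolver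
open import Data.Bool using (if_then_else_)
open import Data.Fin using (Fin; zero; suc; toℕ; fromℕ; inject₁; punchIn)
import Data.Fin.Permutation as Perm
import Data.Fin.Properties as Fin
import Data.Fin.Subset as Sub
open import Data.Fin.Subset using (Subset; ∣_∣; _∩_; _∪_; ∁; ⁅_⁆; inside; outside)
import Data.Fin.Subset.Properties as Sub
open import Data.Integer as ℤ using (ℤ; -[1+_]; 1ℤ)
import Data.Integer.Divisibility as ℤ
import Data.Integer.Properties as ℤ
open import Data.Nat using (ℕ; zero; suc; _+_; _*_; _^_; _∸_; _≤_; _<_; z≤n; s≤s)
open import Data.Nat.Combinatorics using (_C_; nC1≡n; nCn≡1; nCk+nC[k+1]≡[n+1]C[k+1])
open import Data.Nat.Coprimality using (Coprime; coprime-Bézout; gcd≡1⇒coprime)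
open import Data.Nat.Divisibility using (_∣_; divides; quotient; ∣⇒≤; m∣m*n)
open import Data.Nat.GCD using (gcd[m,n]∣m; gcd[m,n]∣n; module Bézout)
open import Data.Nat.Primality using (Prime; euclidsLemma; prime⇒irreducible)
import Data.Nat.Properties as ℕ
open import Data.Nat.Solver using (module +-*-Solver)
import Data.Product as Product
open import Data.Product using (∃-syntax; _×_; _,_; proj₁)
open import Data.Sum using (inj₁; inj₂)
open import Data.Vec using ([]; _∷_; here; there)
import Data.Vec.Properties as Vec
open import Function using (_∘_; Inverse)
open import Level using (_⊔_)
open import Relation.Binary.PropositionalEquality as ≡ using (_≡_; _≢_)
open import Relation.Nullary using (¬_; Dec; yes; no; does; ¬?; _×-dec_; contradiction)
open import Relation.Nullary.Decidable using (dec-true; dec-false)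
open import Relation.Unary using (Decidable)
open import Defs

-- Prime divisibility of binomial coefficients.

-- Absorption identity, by induction through Pascal's rule. Its multiplicative form lets Euclid's
-- lemma act on `p C k`.
1+k*[1+n]C[1+k]≡1+n*nCk : ∀ n k → suc k * (suc n C suc k) ≡ suc n * (n C k)
1+k*[1+n]C[1+k]≡1+n*nCk n zero = begin
  1 * (suc n C 1)    ≡⟨ ℕ.*-identityˡ _ ⟩
  suc n C 1          ≡⟨ nC1≡n (suc n) ⟩
  suc n              ≡⟨ ℕ.*-identityʳ _ ⟨
  suc n * 1          ∎
  where open ≡.≡-Reasoning
1+k*[1+n]C[1+k]≡1+n*nCk zero (suc k) = ℕ.*-zeroʳ (suc (suc k))
1+k*[1+n]C[1+k]≡1+n*nCk (suc n) (suc k) = begin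
  suc (suc k) * (suc (suc n) C suc (suc k))
    ≡⟨ ≡.cong (suc (suc k) *_) (nCk+nC[k+1]≡[n+1]C[k+1] (suc n) (suc k)) ⟨
  suc (suc k) * (a + b)
    ≡⟨ solve 3 (λ k a b → (con 2 :+ k) :* (a :+ b) :=
         a :+ ((con 1 :+ k) :* a :+ (con 2 :+ k) :* b)) ≡.refl k a b ⟩
  a + (suc k * a + suc (suc k) * b)
    ≡⟨ ≡.cong (a +_) (≡.cong₂ _+_ (1+k*[1+n]C[1+k]≡1+n*nCk n k) (1+k*[1+n]C[1+k]≡1+n*nCk n (suc k))) ⟩
  a + (suc n * (n C k) + suc n * (n C suc k))
    ≡⟨ ≡.cong (a +_) (ℕ.*-distribˡ-+ (suc n) (n C k) (n C suc k)) ⟨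
  a + suc n * (n C k + n C suc k)
    ≡⟨ ≡.cong (λ c → a + suc n * c) (nCk+nC[k+1]≡[n+1]C[k+1] n k) ⟩
  suc (suc n) * a ∎
  where
  open ≡.≡-Reasoning
  open +-*-Solver
  a = suc n C suc k
  b = suc n C suc (suc k)

-- By absorption `k * (p C k)` is a multiple of `p`, and `p` is too large to divide `k`.
p∣pCk : ∀ {p k} → Prime p → 0 < k → k < p → p ∣ p C k
p∣pCk {suc n} {suc k} p-prime _ k<p
  with euclidsLemma (suc k) (suc n C suc k) p-prime
         (≡.subst (suc n ∣_) (≡.sym (1+k*[1+n]C[1+k]≡1+n*nCk n k)) (m∣m*n (n C k)))
... | inj₁ p∣k   = contradiction (∣⇒≤ p∣k) (ℕ.<⇒≱ k<p)
... | inj₂ p∣pCk = p∣pCk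

prime∤⇒coprime : ∀ {p n} → Prime p → ¬ p ∣ n → Coprime p n
prime∤⇒coprime {p} {n} p-prime p∤n
  with prime⇒irreducible p-prime (gcd[m,n]∣m p n)
... | inj₁ gcd≡1 = gcd≡1⇒coprime gcd≡1
... | inj₂ gcd≡p = contradiction (≡.subst (_∣ n) gcd≡p (gcd[m,n]∣n p n)) p∤n

-- Cardinalities of finite sets.

∣p∪q∣≤∣p∣+∣q∣ : ∀ {n} (p q : Subset n) → ∣ p ∪ q ∣ ≤ ∣ p ∣ + ∣ q ∣
∣p∪q∣≤∣p∣+∣q∣ []            []            = z≤n
∣p∪q∣≤∣p∣+∣q∣ (outside ∷ p) (outside ∷ q) = ∣p∪q∣≤∣p∣+∣q∣ p q
∣p∪q∣≤∣p∣+∣q∣ (inside ∷ p)  (outside ∷ q) = s≤s (∣p∪q∣≤∣p∣+∣q∣ p q)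
∣p∪q∣≤∣p∣+∣q∣ (outside ∷ p) (inside ∷ q)  =
  ≡.subst (suc ∣ p ∪ q ∣ ≤_) (≡.sym (ℕ.+-suc ∣ p ∣ ∣ q ∣)) (s≤s (∣p∪q∣≤∣p∣+∣q∣ p q))
∣p∪q∣≤∣p∣+∣q∣ (inside ∷ p)  (inside ∷ q)  =
  s≤s (ℕ.≤-trans (∣p∪q∣≤∣p∣+∣q∣ p q) (ℕ.+-monoʳ-≤ ∣ p ∣ (ℕ.n≤1+n ∣ q ∣)))

∣p∣≤1+∣p-x∣ : ∀ {n} (p : Subset n) x → ∣ p ∣ ≤ suc ∣ p Sub.- x ∣
∣p∣≤1+∣p-x∣ p x = begin
  ∣ p ∣                      ≤⟨ Sub.p⊆q⇒∣p∣≤∣q∣ p⊆x∪p-x ⟩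
  ∣ ⁅ x ⁆ ∪ (p Sub.- x) ∣      ≤⟨ ∣p∪q∣≤∣p∣+∣q∣ ⁅ x ⁆ (p Sub.- x) ⟩
  ∣ ⁅ x ⁆ ∣ + ∣ p Sub.- x ∣   ≡⟨ ≡.cong (_+ ∣ p Sub.- x ∣) (Sub.∣⁅x⁆∣≡1 x) ⟩
  suc ∣ p Sub.- x ∣          ∎
  where
  open ℕ.≤-Reasoning
  p⊆x∪p-x : p Sub.⊆ ⁅ x ⁆ ∪ (p Sub.- x)
  p⊆x∪p-x {y} y∈p with y Sub.∈? ⁅ x ⁆
  ... | yes y∈x = Sub.x∈p∪q⁺ (inj₁ y∈x)
  ... | no  y∉x = Sub.x∈p∪q⁺ (inj₂ (Sub.x∈p∧x∉q⇒x∈p─q y∈p y∉x))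

x∈p-y⇒x≢y : ∀ {n} (p : Subset n) {x y} → x Sub.∈ p Sub.- y → x ≢ y
x∈p-y⇒x≢y (_ ∷ p) {zero}  {zero}  () ≡.refl
x∈p-y⇒x≢y (_ ∷ p) {suc x} {suc y} (there x∈p-y) ≡.refl = x∈p-y⇒x≢y p x∈p-y ≡.refl

Empty⇒∣p∣≡0 : ∀ {n} {p : Subset n} → Sub.Empty p → ∣ p ∣ ≡ 0
Empty⇒∣p∣≡0 {n} empty = ≡.trans (≡.cong ∣_∣ (Sub.Empty-unique empty)) (Sub.∣⊥∣≡0 n)

2≤∣p∣⇒∃≢ : ∀ {n} (p : Subset n) → 2 ≤ ∣ p ∣ → ∃[ x ] ∃[ y ] (x Sub.∈ p × y Sub.∈ p × x ≢ y)
2≤∣p∣⇒∃≢ p 2≤∣p∣ with Sub.nonempty? p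
... | no  empty = contradiction (≡.subst (2 ≤_) (Empty⇒∣p∣≡0 empty) 2≤∣p∣) λ ()
... | yes (x , x∈p) with Sub.nonempty? (p Sub.- x)
...   | no  empty = contradiction
  (ℕ.≤-trans 2≤∣p∣ (≡.subst (λ m → ∣ p ∣ ≤ suc m) (Empty⇒∣p∣≡0 empty) (∣p∣≤1+∣p-x∣ p x)))
  λ { (s≤s ()) }
...   | yes (y , y∈p-x) =
  x , y , x∈p , Sub.p─q⊆p p ⁅ x ⁆ y∈p-x , x∈p-y⇒x≢y p y∈p-x ∘ ≡.sym

⋃ : ∀ {m n} → Subset m → (Fin m → Subset n) → Subset n
⋃ []            R = Sub.⊥
⋃ (inside ∷ p)  R = R zero ∪ ⋃ p (R ∘ suc)
⋃ (outside ∷ p) R = ⋃ p (R ∘ suc)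

x∈⋃⁺ : ∀ {m n} {p : Subset m} {R : Fin m → Subset n} {i x} →
       i Sub.∈ p → x Sub.∈ R i → x Sub.∈ ⋃ p R
x∈⋃⁺ {p = inside ∷ p}  here        x∈R = Sub.x∈p∪q⁺ (inj₁ x∈R)
x∈⋃⁺ {p = inside ∷ p}  (there i∈p) x∈R = Sub.x∈p∪q⁺ (inj₂ (x∈⋃⁺ i∈p x∈R))
x∈⋃⁺ {p = outside ∷ p} (there i∈p) x∈R = x∈⋃⁺ i∈p x∈R

-- Union bound. Applied twice, it counts the `k`-th roots of all sums `s + u`.
∣⋃∣≤ : ∀ {m n k} (p : Subset m) (R : Fin m → Subset n) → (∀ i → ∣ R i ∣ ≤ k) →
       ∣ ⋃ p R ∣ ≤ ∣ p ∣ * k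
∣⋃∣≤ {n = n} [] R R≤k = ℕ.≤-reflexive (Sub.∣⊥∣≡0 n)
∣⋃∣≤ (outside ∷ p) R R≤k = ∣⋃∣≤ p (R ∘ suc) (R≤k ∘ suc)
∣⋃∣≤ (inside ∷ p)  R R≤k = ℕ.≤-trans
  (∣p∪q∣≤∣p∣+∣q∣ (R zero) (⋃ p (R ∘ suc)))
  (ℕ.+-mono-≤ (R≤k zero) (∣⋃∣≤ p (R ∘ suc) (R≤k ∘ suc)))

-- Polynomial functions with a prescribed leading coefficient.

module PolynomialFunctions {c ℓ} (R : CommutativeRing c ℓ) where
  open CommutativeRing R hiding (zero) renaming (_+_ to _+ᴿ_; _*_ to _*ᴿ_)
  open Exp commutativeSemiring using () renaming (_^_ to _^ᴿ_; ^-congˡ to ^ᴿ-congˡ)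
  open Mult semiring using () renaming (_×_ to _×ᴿ_)
  open SemiringSolver commutativeSemiring using (solve; _:=_; _:+_; _:*_; con)
  open import Relation.Binary.Reasoning.Setoid setoid

  -- Polynomial n c f: f is given by a polynomial of formal degree n whose coefficient
  -- at X ^ n is c (possibly 0#), presented in Horner form.
  data Polynomial : ℕ → Carrier → (Carrier → Carrier) → Set (c ⊔ ℓ) where
    const : ∀ {c f} → (∀ x → f x ≈ c) → Polynomial 0 c f
    step  : ∀ {n c f g} c₀ → Polynomial n c g → (∀ x → f x ≈ c₀ +ᴿ x *ᴿ g x) →
            Polynomial (suc n) c f

  private
    variable
      m n : ℕ
      a b : Carrier
      f g : Carrier → Carrier

  ≗-resp : (∀ x → g x ≈ f x) → Polynomial n a f → Polynomial n a g
  ≗-resp g≈f (const eq)   = const λ x → trans (g≈f x) (eq x)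
  ≗-resp g≈f (step d P eq) = step d P λ x → trans (g≈f x) (eq x)

  lead-resp : a ≈ b → Polynomial n a f → Polynomial n b f
  lead-resp a≈b (const eq)    = const λ x → trans (eq x) a≈b
  lead-resp a≈b (step d P eq) = step d (lead-resp a≈b P) eq

  infixl 6 _⊞_
  _⊞_ : Polynomial n a f → Polynomial n b g → Polynomial n (a +ᴿ b) (λ x → f x +ᴿ g x)
  const eq ⊞ const eq′ = const λ x → +-cong (eq x) (eq′ x)
  step d P eq ⊞ step d′ P′ eq′ = step (d +ᴿ d′) (P ⊞ P′) λ x → trans
    (+-cong (eq x) (eq′ x))
    (solve 5 (λ d x g d′ g′ → (d :+ x :* g) :+ (d′ :+ x :* g′) := (d :+ d′) :+ x :* (g :+ g′))
      refl d x _ d′ _)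

  scale : ∀ s → Polynomial n a f → Polynomial n (s *ᴿ a) (λ x → s *ᴿ f x)
  scale s (const eq) = const λ x → *-congˡ (eq x)
  scale s (step d P eq) = step (s *ᴿ d) (scale s P) λ x → trans
    (*-congˡ (eq x))
    (solve 4 (λ s d x g → s :* (d :+ x :* g) := s :* d :+ x :* (s :* g)) refl s d x _)

  zeroPolynomial : ∀ n → Polynomial n 0# (λ _ → 0#)
  zeroPolynomial zero    = const λ _ → refl
  zeroPolynomial (suc n) = step 0# (zeroPolynomial n) λ x →
    solve 1 (λ x → con 0 := con 0 :+ x :* con 0) refl x

  -- Raising the formal degree puts `0#` in the leading place, so terms of lower degree can be added
  -- without disturbing a leading coefficient.
  pad : m < n → Polynomial m a f → Polynomial n 0# f
  pad {n = suc n} _ (const {a} eq) = step a (zeroPolynomial n) λ x →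
    trans (eq x) (solve 2 (λ a x → a := a :+ x :* con 0) refl a x)
  pad (s≤s m<n) (step d P eq) = step d (pad m<n P) eq

  -- The degree is positive because at degree 0 the added constant would change the leading
  -- coefficient.
  addConst : ∀ v → Polynomial (suc n) a f → Polynomial (suc n) a (λ x → f x +ᴿ v)
  addConst v (step d P eq) = step (d +ᴿ v) P λ x → trans (+-congʳ (eq x))
    (solve 4 (λ d x g v → (d :+ x :* g) :+ v := (d :+ v) :+ x :* g) refl d x _ v)

  mulX : Polynomial n a f → Polynomial (suc n) a (λ x → x *ᴿ f x)
  mulX P = step 0# P λ x → sym (+-identityˡ _)

  mulX+ : ∀ d → Polynomial n a f → Polynomial (suc n) a (λ x → (x +ᴿ d) *ᴿ f x)
  mulX+ d P = ≗-resp (λ x → distribʳ _ x d)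
    (lead-resp (+-identityʳ _) (mulX P ⊞ pad ℕ.≤-refl (scale d P)))

  mulX+^ : ∀ d m → Polynomial n a f → Polynomial (m + n) a (λ x → (x +ᴿ d) ^ᴿ m *ᴿ f x)
  mulX+^ d zero P = ≗-resp (λ x → *-identityˡ _) P
  mulX+^ d (suc m) P = ≗-resp (λ x → *-assoc _ _ _) (mulX+ d (mulX+^ d m P))

  mulX^ : ∀ m → Polynomial n a f → Polynomial (m + n) a (λ x → x ^ᴿ m *ᴿ f x)
  mulX^ m P = ≗-resp (λ x → *-congʳ (^ᴿ-congˡ m (sym (+-identityʳ x)))) (mulX+^ 0# m P)

  powerX : ∀ m → Polynomial m 1# (_^ᴿ m)
  powerX zero    = const λ _ → refl
  powerX (suc m) = mulX (powerX m)

  -- Shifting `e + x * g x` gives the monic factor `x + d` times the shifted `g`, plus `e`, so the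
  -- leading coefficient survives.
  shift : ∀ d → Polynomial n a f → Polynomial n a (λ x → f (x +ᴿ d))
  shift d (const eq) = const λ x → eq (x +ᴿ d)
  shift d (step e P eq) = ≗-resp
    (λ x → trans (eq (x +ᴿ d)) (+-comm e _))
    (addConst e (mulX+ d (shift d P)))

  x-expand : ∀ x y → x ≈ y +ᴿ (x - y)
  x-expand x y = begin
    x                 ≈⟨ +-identityʳ x ⟨
    x +ᴿ 0#           ≈⟨ +-congˡ (-‿inverseʳ y) ⟨
    x +ᴿ (y - y)      ≈⟨ solve 3 (λ x y z → x :+ (y :+ z) := y :+ (x :+ z)) refl x y (- y) ⟩
    y +ᴿ (x - y)      ∎

  -- Division by `X - y`: if `f = d + X g` and `g = g y + (X - y) h`, then
  -- `f = f y + (X - y) (g + y h)`. The term `y h` has lower degree than `g`, so the quotient keeps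
  -- the leading coefficient.
  factor : ∀ y → Polynomial (suc n) a f →
           ∃[ g ] (Polynomial n a g × ∀ x → f x ≈ f y +ᴿ (x - y) *ᴿ g x)
  factor {a = a} {f = f} y (step {g = g} d (const g≈a) eq) =
    (λ _ → a) , const (λ _ → refl) , λ x → begin
    f x                               ≈⟨ eq x ⟩
    d +ᴿ x *ᴿ g x                     ≈⟨ +-congˡ (*-cong (x-expand x y) (g≈a x)) ⟩
    d +ᴿ (y +ᴿ (x - y)) *ᴿ a
      ≈⟨ solve 4 (λ d y z a → d :+ (y :+ z) :* a := (d :+ y :* a) :+ z :* a) refl d y (x - y) a ⟩
    (d +ᴿ y *ᴿ a) +ᴿ (x - y) *ᴿ a     ≈⟨ +-congʳ (+-congˡ (*-congˡ (g≈a y))) ⟨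
    (d +ᴿ y *ᴿ g y) +ᴿ (x - y) *ᴿ a   ≈⟨ +-congʳ (eq y) ⟨
    f y +ᴿ (x - y) *ᴿ a               ∎
  factor {f = f} y (step {g = g} d P@(step _ _ _) eq) with factor y P
  ... | h , H , g≈ =
    (λ x → g x +ᴿ y *ᴿ h x) ,
    lead-resp (+-identityʳ _) (P ⊞ pad ℕ.≤-refl (scale y H)) ,
    λ x → begin
      f x                                                 ≈⟨ eq x ⟩
      d +ᴿ x *ᴿ g x                                       ≈⟨ +-congˡ (*-congʳ (x-expand x y)) ⟩
      d +ᴿ (y +ᴿ (x - y)) *ᴿ g x
        ≈⟨ solve 4 (λ d y z g → d :+ (y :+ z) :* g :=
             d :+ (y :* g :+ z :* g)) refl d y (x - y) (g x) ⟩
      d +ᴿ (y *ᴿ g x +ᴿ (x - y) *ᴿ g x)                   ≈⟨ +-congˡ (+-congʳ (*-congˡ (g≈ x))) ⟩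
      d +ᴿ (y *ᴿ (g y +ᴿ (x - y) *ᴿ h x) +ᴿ (x - y) *ᴿ g x)
        ≈⟨ solve 6 (λ d y e z h g → d :+ (y :* (e :+ z :* h) :+ z :* g) :=
             (d :+ y :* e) :+ z :* (g :+ y :* h)) refl d y (g y) (x - y) (h x) (g x) ⟩
      (d +ᴿ y *ᴿ g y) +ᴿ (x - y) *ᴿ (g x +ᴿ y *ᴿ h x)     ≈⟨ +-congʳ (eq y) ⟨
      f y +ᴿ (x - y) *ᴿ (g x +ᴿ y *ᴿ h x)                 ∎

  -- The leading powers cancel. Multiplying `x ^ (1 + n) + g x` by `x + d` contributes a further
  -- `d * x ^ (1 + n)`, so each step raises the multiple of `d` at the top by one.
  [X+d]^[1+n]-X^[1+n] : ∀ d n →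
    ∃[ g ] (Polynomial n (suc n ×ᴿ d) g × ∀ x → (x +ᴿ d) ^ᴿ suc n ≈ x ^ᴿ suc n +ᴿ g x)
  [X+d]^[1+n]-X^[1+n] d zero = (λ _ → d +ᴿ 0#) , const (λ _ → refl) , λ x →
    solve 2 (λ x d → (x :+ d) :* con 1 := x :* con 1 :+ (d :+ con 0)) refl x d
  [X+d]^[1+n]-X^[1+n] d (suc n) with [X+d]^[1+n]-X^[1+n] d n
  ... | g , G , eq =
    (λ x → d *ᴿ x ^ᴿ suc n +ᴿ (x +ᴿ d) *ᴿ g x) ,
    lead-resp (+-congʳ (*-identityʳ d)) (scale d (powerX (suc n)) ⊞ mulX+ d G) ,
    λ x → trans (*-congˡ (eq x))
      (solve 4 (λ x d y g → (x :+ d) :* (y :+ g) := x :* y :+ (d :* y :+ (x :+ d) :* g))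
        refl x d (x ^ᴿ suc n) (g x))

-- Inverses and cancellation in a finite field.

module FiniteFieldProperties {c ℓ₁ ℓ₂ q} (F : FiniteField c ℓ₁ ℓ₂ q) where
  open FiniteField F hiding (zero)
    renaming (_+_ to _+ᴿ_; _*_ to _*ᴿ_; _^_ to _^ᴿ_; ^-congˡ to ^ᴿ-congˡ)
  open FieldSubsets F
  open PolynomialFunctions commutativeRing
  open HeytingField heytingField using (_#_; tight; #⇒invertible; invertible⇒#; #-irrefl)
  open Mult semiring using () renaming
    (_×_ to _×ᴿ_; ×1-homo-* to ×ᴿ1-homo-*; ×-assoc-* to ×ᴿ-assoc-*; ×-congʳ to ×ᴿ-congʳ)
  open Exp commutativeSemiring using (^-homo-*; ^-assocʳ; ^-congʳ)
  open RingProperties ring using (+-cancelˡ; +-cancelʳ; x≈y⇒x∙y⁻¹≈ε; x∙y⁻¹≈ε⇒x≈y)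
  open SemiringSolver commutativeSemiring using (solve; _:=_; _:+_; _:*_; con)
  open import Relation.Binary.Reasoning.Setoid setoid
  private
    module Additive = MonoidSum +-commutativeMonoid
    module Multiplicative = MonoidSum *-commutativeMonoid

  -- Apartness from `0#` means that `x - 0#` is invertible; this turns it into a statement about
  -- `x`.
  x-0≈x : ∀ x → x - 0# ≈ x
  x-0≈x x = sym (trans (x-expand x 0#) (+-identityˡ _))

  1≉0 : 1# ≉ 0#
  1≉0 1≈0 = #-irrefl 1≈0 (invertible⇒#
    (1# , trans (*-identityˡ _) (x-0≈x 1#) , trans (*-identityʳ _) (x-0≈x 1#)))

  -- The witness is found by search, because x ≉ 0# yields an apartness only
  -- under a double negation.
  inverse : ∀ {x} → x ≉ 0# → ∃[ y ] y *ᴿ x ≈ 1#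
  inverse {x} x≉0
    with ∃? {P = λ y → y *ᴿ x ≈ 1#}
      (λ y≈z yx≈1 → trans (*-congʳ (sym y≈z)) yx≈1) (λ y → y *ᴿ x ≟ 1#)
  ... | yes y,yx≈1 = y,yx≈1
  ... | no  ∄y     = contradiction (proj₁ (tight x 0#) ¬x#0) x≉0
    where
    ¬x#0 : ¬ x # 0#
    ¬x#0 x#0 with #⇒invertible x#0
    ... | y , yx≈1 , _ = ∄y (y , trans (*-congˡ (sym (x-0≈x x))) yx≈1)

  *-cancelˡ : ∀ {x y z} → x ≉ 0# → x *ᴿ y ≈ x *ᴿ z → y ≈ z
  *-cancelˡ {x} {y} {z} x≉0 xy≈xz with inverse x≉0
  ... | w , wx≈1 = begin
    y               ≈⟨ *-identityˡ y ⟨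
    1# *ᴿ y         ≈⟨ *-congʳ wx≈1 ⟨
    (w *ᴿ x) *ᴿ y   ≈⟨ *-assoc w x y ⟩
    w *ᴿ (x *ᴿ y)   ≈⟨ *-congˡ xy≈xz ⟩
    w *ᴿ (x *ᴿ z)   ≈⟨ *-assoc w x z ⟨
    (w *ᴿ x) *ᴿ z   ≈⟨ *-congʳ wx≈1 ⟩
    1# *ᴿ z         ≈⟨ *-identityˡ z ⟩
    z               ∎

  *-cancelˡ-0 : ∀ {x y} → x ≉ 0# → x *ᴿ y ≈ 0# → y ≈ 0#
  *-cancelˡ-0 x≉0 xy≈0 = *-cancelˡ x≉0 (trans xy≈0 (sym (zeroʳ _)))

  x≉0∧y≉0⇒xy≉0 : ∀ {x y} → x ≉ 0# → y ≉ 0# → x *ᴿ y ≉ 0#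
  x≉0∧y≉0⇒xy≉0 x≉0 y≉0 xy≈0 = y≉0 (*-cancelˡ-0 x≉0 xy≈0)

  x≉0⇒x^n≉0 : ∀ {x} n → x ≉ 0# → x ^ᴿ n ≉ 0#
  x≉0⇒x^n≉0 zero    x≉0 = 1≉0
  x≉0⇒x^n≉0 (suc n) x≉0 = x≉0∧y≉0⇒xy≉0 x≉0 (x≉0⇒x^n≉0 n x≉0)

  x^n≈0⇒x≈0 : ∀ {x} n → x ^ᴿ n ≈ 0# → x ≈ 0#
  x^n≈0⇒x≈0 {x} n x^n≈0 with x ≟ 0#
  ... | yes x≈0 = x≈0
  ... | no  x≉0 = contradiction x^n≈0 (x≉0⇒x^n≉0 n x≉0)

  -- Sums and products over all field elements.

  open Inverse enumeration using () renaming (strictlyInverseʳ to index-element)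

  element-injective : ∀ {i j} → element i ≈ element j → i ≡ j
  element-injective {i} {j} eq =
    ≡.trans (≡.sym (index-element i)) (≡.trans (index-cong eq) (index-element j))

  -- A bijection of the field becomes a permutation of the indices, along which sums and products
  -- over `Fin q` can be reindexed.
  permute : (φ ψ : Carrier → Carrier) →
            (∀ {x y} → x ≈ y → φ x ≈ φ y) → (∀ {x y} → x ≈ y → ψ x ≈ ψ y) →
            (∀ x → φ (ψ x) ≈ x) → (∀ x → ψ (φ x) ≈ x) → Perm.Permutation q q
  permute φ ψ φ-cong ψ-cong φψ ψφ = Perm.permutation (index ∘ φ ∘ element) (index ∘ ψ ∘ element)
    (λ i → element-injective (trans (element-index _) (trans (φ-cong (element-index _)) (φψ _))))
    (λ i → element-injective (trans (element-index _) (trans (ψ-cong (element-index _)) (ψφ _))))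

  -- Translation by 1# permutes the field, so the sum of all elements equals itself plus q × 1#.
  q×1≈0 : q ×ᴿ 1# ≈ 0#
  q×1≈0 = +-cancelʳ Σ (q ×ᴿ 1#) 0# (begin
    q ×ᴿ 1# +ᴿ Σ                                        ≈⟨ +-congʳ (Additive.sum-replicate q) ⟨
    Additive.sum {q} (λ _ → 1#) +ᴿ Σ                    ≈⟨ Additive.∑-distrib-+ {q} (λ _ → 1#) element ⟨
    Additive.sum {q} (λ i → 1# +ᴿ element i)            ≈⟨ Additive.sum-cong-≋ {q} (λ i → sym (element-index _)) ⟩
    Additive.sum {q} (λ i → element (index (1# +ᴿ element i))) ≈⟨ Additive.sum-permute element translation ⟨
    Σ                                                   ≈⟨ +-identityˡ Σ ⟨
    0# +ᴿ Σ                                             ∎)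
    where
    Σ = Additive.sum {q} element
    cancel : ∀ {a b} → a +ᴿ b ≈ 0# → ∀ x → a +ᴿ (b +ᴿ x) ≈ x
    cancel a+b≈0 x = trans (sym (+-assoc _ _ x)) (trans (+-congʳ a+b≈0) (+-identityˡ x))
    translation : Perm.Permutation q q
    translation = permute (1# +ᴿ_) (- 1# +ᴿ_) +-congˡ +-congˡ
      (cancel (-‿inverseʳ 1#)) (cancel (-‿inverseˡ 1#))

  ∏ : ∀ {n} → (Fin n → Carrier) → Carrier
  ∏ = Multiplicative.sum

  ∏≉0 : ∀ {n} (f : Fin n → Carrier) → (∀ i → f i ≉ 0#) → ∏ f ≉ 0#
  ∏≉0 {zero}  f f≉0 = 1≉0
  ∏≉0 {suc n} f f≉0 = x≉0∧y≉0⇒xy≉0 (f≉0 zero) (∏≉0 (f ∘ suc) (f≉0 ∘ suc))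

  -- The exceptional factor accounts for the exponent `q ∸ 1` in Fermat's theorem: only the nonzero
  -- elements contribute an `x`.
  ∏-constant-except : ∀ {n} {x} (f : Fin n → Carrier) i →
                       f i ≈ 1# → (∀ j → j ≢ i → f j ≈ x) → ∏ f ≈ x ^ᴿ (n ∸ 1)
  ∏-constant-except {suc n} {x} f i fi≈1 f≈x = begin
    ∏ f                              ≈⟨ Multiplicative.sum-remove {i = i} f ⟩
    f i *ᴿ ∏ (f ∘ punchIn i)     ≈⟨ *-congʳ fi≈1 ⟩
    1# *ᴿ ∏ (f ∘ punchIn i)      ≈⟨ *-identityˡ _ ⟩
    ∏ (f ∘ punchIn i)            ≈⟨ Multiplicative.sum-cong-≋ (λ j → f≈x _ (Fin.punchInᵢ≢i i j)) ⟩
    ∏ {n} (λ _ → x)                  ≈⟨ Multiplicative.sum-replicate n ⟩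
    x ^ᴿ n                           ∎

  -- Multiplication by x permutes the nonzero elements; the factor at 0# is replaced by 1#.
  x^[q-1]≈1 : ∀ {x} → x ≉ 0# → x ^ᴿ (q ∸ 1) ≈ 1#
  x^[q-1]≈1 {x} x≉0 with inverse x≉0
  -- `P` is the product of the nonzero elements. Scaling by `x` preserves it, so `∏ h * P = P`, and
  -- the nonzero `P` cancels.
  ... | y , yx≈1 = trans (sym ∏h≈x^[q-1])
    (*-cancelˡ (∏≉0 (unit ∘ element) (unit≉0 ∘ element))
      (trans (*-comm P _) (trans ∏h*P≈P (sym (*-identityʳ P)))))
    where
    replace0 : Carrier → Carrier → Carrier
    replace0 z w = if does (z ≟ 0#) then 1# else w
    replace0-≈0 : ∀ {z w} → z ≈ 0# → replace0 z w ≈ 1#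
    replace0-≈0 {z} z≈0 rewrite dec-true (z ≟ 0#) z≈0 = refl
    replace0-≉0 : ∀ {z w} → z ≉ 0# → replace0 z w ≈ w
    replace0-≉0 {z} z≉0 rewrite dec-false (z ≟ 0#) z≉0 = refl

    unit : Carrier → Carrier
    unit z = replace0 z z
    unit≉0 : ∀ z → unit z ≉ 0#
    unit≉0 z with z ≟ 0#
    ... | yes z≈0 = 1≉0 ∘ trans (sym (replace0-≈0 z≈0))
    ... | no  z≉0 = z≉0 ∘ trans (sym (replace0-≉0 z≉0))

    h : Fin q → Carrier
    h i = replace0 (element i) x
    P = ∏ (unit ∘ element)

    ∏h≈x^[q-1] : ∏ h ≈ x ^ᴿ (q ∸ 1)
    ∏h≈x^[q-1] = ∏-constant-except h (index 0#) (replace0-≈0 (element-index 0#))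
      (λ j j≢0 → replace0-≉0 λ j≈0 → j≢0 (element-injective (trans j≈0 (sym (element-index 0#)))))

    cancel : ∀ {a b} → a *ᴿ b ≈ 1# → ∀ z → a *ᴿ (b *ᴿ z) ≈ z
    cancel ab≈1 z = trans (sym (*-assoc _ _ z)) (trans (*-congʳ ab≈1) (*-identityˡ z))
    scaling : Perm.Permutation q q
    scaling = permute (x *ᴿ_) (y *ᴿ_) *-congˡ *-congˡ (cancel (trans (*-comm x y) yx≈1)) (cancel yx≈1)

    h*unit : ∀ i → h i *ᴿ unit (element i) ≈ unit (element (index (x *ᴿ element i)))
    h*unit i with element i ≟ 0#
    ... | yes i≈0 = trans (trans (*-cong (replace0-≈0 i≈0) (replace0-≈0 i≈0)) (*-identityˡ 1#))
      (sym (replace0-≈0 (trans (element-index _) (trans (*-congˡ i≈0) (zeroʳ x)))))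
    ... | no  i≉0 = trans (*-cong (replace0-≉0 i≉0) (replace0-≉0 i≉0)) (sym (trans
      (replace0-≉0 (λ xi≈0 → x≉0∧y≉0⇒xy≉0 x≉0 i≉0 (trans (sym (element-index _)) xi≈0)))
      (element-index _)))

    ∏h*P≈P : ∏ h *ᴿ P ≈ P
    ∏h*P≈P = begin
      ∏ h *ᴿ P                                              ≈⟨ Multiplicative.∑-distrib-+ h (unit ∘ element) ⟨
      ∏ (λ i → h i *ᴿ unit (element i))                     ≈⟨ Multiplicative.sum-cong-≋ h*unit ⟩
      ∏ (λ i → unit (element (index (x *ᴿ element i))))     ≈⟨ Multiplicative.sum-permute (unit ∘ element) scaling ⟨
      P                                                     ∎

  -- Roots of polynomials.

  -- Dividing out one root lowers the degree by one, and the other elements of `S` are roots of the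
  -- quotient because nonzero factors cancel. At degree 0 the value is the nonzero `a`, so no root
  -- is left.
  ∣roots∣≤degree : ∀ {n a f} (S : Subset q) → Polynomial n a f → a ≉ 0# →
                   (∀ {i} → i Sub.∈ S → f (element i) ≈ 0#) → ∣ S ∣ ≤ n
  ∣roots∣≤degree S P a≉0 f≈0 with Sub.nonempty? S
  ... | no  empty = ≡.subst (_≤ _) (≡.sym (Empty⇒∣p∣≡0 empty)) z≤n
  ... | yes (i , i∈S) with P
  ...   | const f≈a = contradiction (trans (sym (f≈a _)) (f≈0 i∈S)) a≉0
  ...   | P@(step {f = f} _ _ _) with factor (element i) P
  ...     | g , G , f≈ = ℕ.≤-trans (∣p∣≤1+∣p-x∣ S i)
    (s≤s (∣roots∣≤degree (S Sub.- i) G a≉0 λ {j} j∈S-i → *-cancelˡ-0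
      (λ j-i≈0 → x∈p-y⇒x≢y S j∈S-i (element-injective (x∙y⁻¹≈ε⇒x≈y _ _ j-i≈0)))
      (begin
        (element j - element i) *ᴿ g (element j)                       ≈⟨ +-identityˡ _ ⟨
        0# +ᴿ (element j - element i) *ᴿ g (element j)                 ≈⟨ +-congʳ (f≈0 i∈S) ⟨
        f (element i) +ᴿ (element j - element i) *ᴿ g (element j)      ≈⟨ f≈ (element j) ⟨
        f (element j)                                                  ≈⟨ f≈0 (Sub.p─q⊆p S ⁅ i ⁆ j∈S-i) ⟩
        0#                                                             ∎)))

  -- The degree must be positive: a constant polynomial takes a single value everywhere.
  ∣fibre∣≤degree : ∀ {n a f v} (S : Subset q) → Polynomial (suc n) a f → a ≉ 0# →
                   (∀ {i} → i Sub.∈ S → f (element i) ≈ v) → ∣ S ∣ ≤ suc n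
  ∣fibre∣≤degree {v = v} S P a≉0 f≈v =
    ∣roots∣≤degree S (addConst (- v) P) a≉0 (λ i∈S → x≈y⇒x∙y⁻¹≈ε (f≈v i∈S))

  -- Characteristic `p`, the Frobenius map and the two degree bounds.

  n×1^m≈n^m×1 : ∀ n m → (n ×ᴿ 1#) ^ᴿ m ≈ (n ^ m) ×ᴿ 1#
  n×1^m≈n^m×1 n zero    = sym (+-identityʳ 1#)
  n×1^m≈n^m×1 n (suc m) = trans (*-congˡ (n×1^m≈n^m×1 n m)) (sym (×ᴿ1-homo-* n (n ^ m)))

  -- The `f`-th power of `p × 1` is `q × 1 = 0`, and a field has no nonzero nilpotent element.
  q≡p^f⇒p×1≈0 : ∀ {p f} → q ≡ p ^ f → p ×ᴿ 1# ≈ 0#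
  q≡p^f⇒p×1≈0 {p} {f} q≡p^f = x^n≈0⇒x≈0 f (begin
    (p ×ᴿ 1#) ^ᴿ f    ≈⟨ n×1^m≈n^m×1 p f ⟩
    (p ^ f) ×ᴿ 1#     ≡⟨ ≡.cong (_×ᴿ 1#) q≡p^f ⟨
    q ×ᴿ 1#           ≈⟨ q×1≈0 ⟩
    0#                ∎)

  -- The shape of a Bézout identity over the natural numbers: two numbers that vanish in the field
  -- cannot differ by 1.
  ¬[1+a≡b] : ∀ {a b} → 1 + a ≡ b → a ×ᴿ 1# ≈ 0# → b ×ᴿ 1# ≉ 0#
  ¬[1+a≡b] ≡.refl a×1≈0 b×1≈0 =
    1≉0 (trans (sym (+-identityʳ 1#)) (trans (+-congˡ (sym a×1≈0)) b×1≈0))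

  module PositiveCharacteristic {p} (p-prime : Prime p) (p×1≈0 : p ×ᴿ 1# ≈ 0#) where

    n×x≈n×1*x : ∀ n x → n ×ᴿ x ≈ (n ×ᴿ 1#) *ᴿ x
    n×x≈n×1*x n x = sym (trans (×ᴿ-assoc-* n 1# x) (×ᴿ-congʳ n (*-identityˡ x)))

    m×1≈0⇒[n*m]×1≈0 : ∀ {m} n → m ×ᴿ 1# ≈ 0# → (n * m) ×ᴿ 1# ≈ 0#
    m×1≈0⇒[n*m]×1≈0 {m} n m×1≈0 = trans (×ᴿ1-homo-* n m) (trans (*-congˡ m×1≈0) (zeroʳ _))

    p∣n⇒n×x≈0 : ∀ {n} x → p ∣ n → n ×ᴿ x ≈ 0#
    p∣n⇒n×x≈0 x (divides n ≡.refl) = begin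
      (n * p) ×ᴿ x            ≈⟨ n×x≈n×1*x (n * p) x ⟩
      ((n * p) ×ᴿ 1#) *ᴿ x    ≈⟨ *-congʳ (m×1≈0⇒[n*m]×1≈0 n p×1≈0) ⟩
      0# *ᴿ x                 ≈⟨ zeroˡ x ⟩
      0#                      ∎

    -- If `n × 1` vanished along with `p × 1`, a Bézout identity for the coprime pair would make
    -- `1#` vanish too.
    p∤n⇒n×1≉0 : ∀ {n} → ¬ p ∣ n → n ×ᴿ 1# ≉ 0#
    p∤n⇒n×1≉0 {n} p∤n n×1≈0 with coprime-Bézout (prime∤⇒coprime p-prime p∤n)
    ... | Bézout.+- x y eq = ¬[1+a≡b] eq (m×1≈0⇒[n*m]×1≈0 y n×1≈0) (m×1≈0⇒[n*m]×1≈0 x p×1≈0)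
    ... | Bézout.-+ x y eq = ¬[1+a≡b] eq (m×1≈0⇒[n*m]×1≈0 x p×1≈0) (m×1≈0⇒[n*m]×1≈0 y n×1≈0)

    p∤n⇒n×x≉0 : ∀ {n x} → ¬ p ∣ n → x ≉ 0# → n ×ᴿ x ≉ 0#
    p∤n⇒n×x≉0 {n} {x} p∤n x≉0 n×x≈0 =
      x≉0∧y≉0⇒xy≉0 (p∤n⇒n×1≉0 p∤n) x≉0 (trans (sym (n×x≈n×1*x n x)) n×x≈0)

    -- Every inner binomial coefficient is a multiple of `p`, so only the two extreme terms of the
    -- expansion survive.
    [x+y]^p≈x^p+y^p : ∀ x y → (x +ᴿ y) ^ᴿ p ≈ x ^ᴿ p +ᴿ y ^ᴿ p
    [x+y]^p≈x^p+y^p x y = expand p-prime ≡.refl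
      where
      -- Generalising `p` to `n` allows a match on `suc n`, which exposes the first and last terms;
      -- primality excludes 0.
      expand : ∀ {n} → Prime n → p ≡ n → (x +ᴿ y) ^ᴿ n ≈ x ^ᴿ n +ᴿ y ^ᴿ n
      expand {suc n} _ p≡1+n = begin
        (x +ᴿ y) ^ᴿ suc n
          ≈⟨ Binomial.theorem commutativeSemiring (suc n) x y ⟩
        term zero +ᴿ Additive.sum (term ∘ suc)
          ≈⟨ +-congˡ (Additive.sum-init-last (term ∘ suc)) ⟩
        term zero +ᴿ (Additive.sum (term ∘ suc ∘ inject₁) +ᴿ term (fromℕ (suc n)))
          ≈⟨ +-cong first (+-cong (trans (Additive.sum-cong-≋ {n} middle) (Additive.sum-replicate-zero n)) last) ⟩
        y ^ᴿ suc n +ᴿ (0# +ᴿ x ^ᴿ suc n)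
          ≈⟨ solve 2 (λ a b → b :+ (con 0 :+ a) := a :+ b) refl (x ^ᴿ suc n) (y ^ᴿ suc n) ⟩
        x ^ᴿ suc n +ᴿ y ^ᴿ suc n ∎
        where
        term = Binomial.binomialTerm commutativeSemiring x y (suc n)
        first : term zero ≈ y ^ᴿ suc n
        first = trans (+-identityʳ _) (*-identityˡ _)
        middle : ∀ i → term (suc (inject₁ i)) ≈ 0#
        middle i rewrite Fin.toℕ-inject₁ i = p∣n⇒n×x≈0 _
          (≡.subst (λ m → p ∣ m C suc (toℕ i)) p≡1+n (p∣pCk p-prime (s≤s z≤n)
            (≡.subst (suc (toℕ i) <_) (≡.sym p≡1+n) (s≤s (Fin.toℕ<n i)))))
        last : term (fromℕ (suc n)) ≈ x ^ᴿ suc n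
        last rewrite Fin.toℕ-fromℕ n | nCn≡1 (suc n) | ℕ.n∸n≡0 n =
          trans (+-identityʳ _) (*-identityʳ _)

    [x+y]^p^e≈x^p^e+y^p^e : ∀ e x y → (x +ᴿ y) ^ᴿ (p ^ e) ≈ x ^ᴿ (p ^ e) +ᴿ y ^ᴿ (p ^ e)
    [x+y]^p^e≈x^p^e+y^p^e zero x y =
      solve 2 (λ x y → (x :+ y) :* con 1 := x :* con 1 :+ y :* con 1) refl x y
    [x+y]^p^e≈x^p^e+y^p^e (suc e) x y = begin
      (x +ᴿ y) ^ᴿ (p * p ^ e)                      ≈⟨ ^-assocʳ (x +ᴿ y) p (p ^ e) ⟨
      ((x +ᴿ y) ^ᴿ p) ^ᴿ (p ^ e)                   ≈⟨ ^ᴿ-congˡ (p ^ e) ([x+y]^p≈x^p+y^p x y) ⟩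
      (x ^ᴿ p +ᴿ y ^ᴿ p) ^ᴿ (p ^ e)                ≈⟨ [x+y]^p^e≈x^p^e+y^p^e e (x ^ᴿ p) (y ^ᴿ p) ⟩
      (x ^ᴿ p) ^ᴿ (p ^ e) +ᴿ (y ^ᴿ p) ^ᴿ (p ^ e)   ≈⟨ +-cong (^-assocʳ x p (p ^ e)) (^-assocʳ y p (p ^ e)) ⟩
      x ^ᴿ (p * p ^ e) +ᴿ y ^ᴿ (p * p ^ e)         ∎

    -- Comparing (x + d) ^ p^e = x ^ p^e + d ^ p^e with (x + d) ^ (2 + n) = x ^ (2 + n) + g x
    -- leaves g x = d ^ p^e, where g has degree 1 + n and leading coefficient (2 + n) × d.
    ∣S∣≤1+n : ∀ {n} e a d (S : Subset q) → d ≉ 0# → ¬ p ∣ 2 + n →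
              (∀ {i} → i Sub.∈ S → let x = element i +ᴿ a in
                x ^ᴿ (p ^ e) ≈ x ^ᴿ (2 + n) × (x +ᴿ d) ^ᴿ (p ^ e) ≈ (x +ᴿ d) ^ᴿ (2 + n)) →
              ∣ S ∣ ≤ suc n
    ∣S∣≤1+n {n} e a d S d≉0 p∤2+n powers with [X+d]^[1+n]-X^[1+n] d (suc n)
    -- The set `S` consists of the elements `x - a`, hence the shift by `a`.
    ... | g , G , [x+d]^[2+n]≈ = ∣fibre∣≤degree S (shift a G) (p∤n⇒n×x≉0 p∤2+n d≉0)
      λ {i} i∈S → let x = element i +ᴿ a; (x^p^e , [x+d]^p^e) = powers i∈S in
        +-cancelˡ (x ^ᴿ (2 + n)) (g x) (d ^ᴿ (p ^ e)) (begin
          x ^ᴿ (2 + n) +ᴿ g x                    ≈⟨ [x+d]^[2+n]≈ x ⟨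
          (x +ᴿ d) ^ᴿ (2 + n)                    ≈⟨ [x+d]^p^e ⟨
          (x +ᴿ d) ^ᴿ (p ^ e)                    ≈⟨ [x+y]^p^e≈x^p^e+y^p^e e x d ⟩
          x ^ᴿ (p ^ e) +ᴿ d ^ᴿ (p ^ e)           ≈⟨ +-congʳ x^p^e ⟩
          x ^ᴿ (2 + n) +ᴿ d ^ᴿ (p ^ e)           ∎)

    -- Multiplying ((x + d) ^ p^e) (x + d) ^ s = 1 by x ^ s clears the inverses: it becomes
    -- D x ^ s (x + d) ^ s + ((x + d) ^ s - x ^ s) = 0 with D = d ^ p^e and s = 1 + n.
    ∣S∣≤2*[1+n] : ∀ {n} e a d (S : Subset q) → d ≉ 0# →
                  (∀ {i} → i Sub.∈ S → let x = element i +ᴿ a in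
                    x ^ᴿ (p ^ e) *ᴿ x ^ᴿ suc n ≈ 1# ×
                    (x +ᴿ d) ^ᴿ (p ^ e) *ᴿ (x +ᴿ d) ^ᴿ suc n ≈ 1#) →
                  ∣ S ∣ ≤ 2 * suc n
    ∣S∣≤2*[1+n] {n} e a d S d≉0 powers with [X+d]^[1+n]-X^[1+n] d n
    ... | g , G , [x+d]^[1+n]≈ = ∣roots∣≤degree S
      (shift a (mulX^ (suc n) (mulX+^ d (suc n) (const {c = D} (λ _ → refl))))
        -- `g` has degree only `n`, so at degree `2 * suc n` it contributes `0#` and the leading
        -- coefficient is `D + 0#`.
        ⊞ shift a (pad (s≤s (ℕ.m≤m+n n (suc n + 0))) G))
      (x≉0⇒x^n≉0 (p ^ e) d≉0 ∘ trans (sym (+-identityʳ D)))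
      λ {i} i∈S →
        let x = element i +ᴿ a
            u = x ^ᴿ (p ^ e)
            y = x ^ᴿ suc n
            z = (x +ᴿ d) ^ᴿ suc n
            (uy≈1 , [x+d]≈1) = powers i∈S
        -- Adding `y` to both sides allows `y + g x` to be replaced by `z`.
        in +-cancelˡ y _ _ (begin
          y +ᴿ (y *ᴿ (z *ᴿ D) +ᴿ g x)
            ≈⟨ solve 4 (λ y z D g → y :+ (y :* (z :* D) :+ g) :=
                 (y :+ g) :+ y :* (z :* D)) refl y z D (g x) ⟩
          (y +ᴿ g x) +ᴿ y *ᴿ (z *ᴿ D)              ≈⟨ +-congʳ ([x+d]^[1+n]≈ x) ⟨
          z +ᴿ y *ᴿ (z *ᴿ D)                       ≈⟨ +-congʳ (*-identityˡ z) ⟨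
          1# *ᴿ z +ᴿ y *ᴿ (z *ᴿ D)                 ≈⟨ +-congʳ (*-congʳ uy≈1) ⟨
          (u *ᴿ y) *ᴿ z +ᴿ y *ᴿ (z *ᴿ D)
            ≈⟨ solve 4 (λ u y z D → (u :* y) :* z :+ y :* (z :* D) :=
                 y :* ((u :+ D) :* z)) refl u y z D ⟩
          y *ᴿ ((u +ᴿ D) *ᴿ z)                     ≈⟨ *-congˡ (*-congʳ ([x+y]^p^e≈x^p^e+y^p^e e x d)) ⟨
          y *ᴿ ((x +ᴿ d) ^ᴿ (p ^ e) *ᴿ z)          ≈⟨ *-congˡ [x+d]≈1 ⟩
          y *ᴿ 1#                                  ≈⟨ *-identityʳ y ⟩
          y                                        ≈⟨ +-identityʳ y ⟨
          y +ᴿ 0#                                  ∎)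
      where
      D = d ^ᴿ (p ^ e)

  -- Exponents modulo `t`.

  x^t≈1⇒t∣n⇒x^n≈1 : ∀ {t n x} → x ^ᴿ t ≈ 1# → t ∣ n → x ^ᴿ n ≈ 1#
  x^t≈1⇒t∣n⇒x^n≈1 {t} {x = x} x^t≈1 (divides m ≡.refl) = begin
    x ^ᴿ (m * t)      ≡⟨ ≡.cong (x ^ᴿ_) (ℕ.*-comm m t) ⟩
    x ^ᴿ (t * m)      ≈⟨ ^-assocʳ x t m ⟨
    (x ^ᴿ t) ^ᴿ m     ≈⟨ ^ᴿ-congˡ m x^t≈1 ⟩
    1# ^ᴿ m           ≈⟨ 1^n≈1 m ⟩
    1#                ∎
    where
    1^n≈1 : ∀ n → 1# ^ᴿ n ≈ 1#
    1^n≈1 zero    = refl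
    1^n≈1 (suc n) = trans (*-identityˡ _) (1^n≈1 n)

  x^m*x^[n∸m]≈x^n : ∀ {m n} x → m ≤ n → x ^ᴿ m *ᴿ x ^ᴿ (n ∸ m) ≈ x ^ᴿ n
  x^m*x^[n∸m]≈x^n {m} {n} x m≤n =
    trans (sym (^-homo-* x m (n ∸ m))) (^-congʳ x (ℕ.m+[n∸m]≡n m≤n))

  -- The larger exponent exceeds the smaller by a multiple of `t`, and this excess contributes a
  -- factor `1#`.
  m≡n[t]⇒x^m≈x^n : ∀ m n {t x} → x ^ᴿ t ≈ 1# → ℤ.+ m ≡ ℤ.+ n [mod t ] → x ^ᴿ m ≈ x ^ᴿ n
  m≡n[t]⇒x^m≈x^n m n {t} {x} x^t≈1 m≡n with ℕ.≤-total m n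
  ... | inj₁ m≤n = trans
    (sym (trans (*-congˡ (x^t≈1⇒t∣n⇒x^n≈1 x^t≈1 t∣n∸m)) (*-identityʳ _)))
    (x^m*x^[n∸m]≈x^n x m≤n)
    where
    t∣n∸m : t ∣ n ∸ m
    t∣n∸m = ≡.subst (t ∣_) (≡.trans (≡.cong ℤ.∣_∣ (ℤ.m-n≡m⊖n m n)) (ℤ.∣⊖∣-≤ m≤n)) m≡n
  ... | inj₂ n≤m = trans
    (sym (x^m*x^[n∸m]≈x^n x n≤m))
    (trans (*-congˡ (x^t≈1⇒t∣n⇒x^n≈1 x^t≈1 t∣m∸n)) (*-identityʳ _))
    where
    t∣m∸n : t ∣ m ∸ n
    t∣m∸n = ≡.subst (t ∣_)
      (≡.trans (≡.cong ℤ.∣_∣ (ℤ.m-n≡m⊖n m n)) (≡.trans (ℤ.∣m⊖n∣≡∣n⊖m∣ m n) (ℤ.∣⊖∣-≤ n≤m))) m≡n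

  -- The difference `+ m - -[1+ n ]` computes to `+ (m + suc n)`, so the congruence is literally the
  -- divisibility `t ∣ m + suc n`.
  m≡-n[t]⇒x^m*x^n≈1 : ∀ m n {t x} → x ^ᴿ t ≈ 1# → ℤ.+ m ≡ -[1+ n ] [mod t ] →
                      x ^ᴿ m *ᴿ x ^ᴿ suc n ≈ 1#
  m≡-n[t]⇒x^m*x^n≈1 m n {x = x} x^t≈1 m≡-n =
    trans (sym (^-homo-* x m (suc n))) (x^t≈1⇒t∣n⇒x^n≈1 x^t≈1 m≡-n)

  -- Membership in comprehensions, translates and sumsets.

  ∈-comprehension⁻ : ∀ {ℓ} {P : Carrier → Set ℓ} (P? : Decidable P) {i} →
                     i Sub.∈ comprehension P P? → P (element i)
  ∈-comprehension⁻ P? {i} i∈ = witness (P? (element i))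
    (≡.trans (≡.sym (Vec.lookup∘tabulate _ i)) (Vec.[]=⇒lookup i∈))
    where
    witness : ∀ {a} {A : Set a} (a? : Dec A) → does a? ≡ inside → A
    witness (yes a) _ = a

  ∈-comprehension⁺ : ∀ {ℓ} {P : Carrier → Set ℓ} (P? : Decidable P) {i} →
                     P (element i) → i Sub.∈ comprehension P P?
  ∈-comprehension⁺ P? {i} Pi =
    Vec.lookup⇒[]= i _ (≡.trans (Vec.lookup∘tabulate _ i) (dec-true (P? (element i)) Pi))

  -- The subsets of Defs unfold to tabulated booleans, so their deciders cannot be
  -- recovered by unification and are rebuilt here.
  ⊝? : ∀ S a → Decidable (λ y → ∃[ x ] (x ∈ S × y ≈ x - a))
  ⊝? S a y = ∃?
    (λ x≈x′ (x∈S , eq) → ∈-resp S x≈x′ x∈S , trans eq (+-congʳ x≈x′))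
    (λ x → (x ∈? S) ×-dec (y ≟ x - a))

  ⊕? : ∀ S T → Decidable (λ z → ∃[ s ] (s ∈ S × ∃[ u ] (u ∈ T × z ≈ s +ᴿ u)))
  ⊕? S T z = ∃?
    (λ s≈s′ (s∈S , u , u∈T , eq) → ∈-resp S s≈s′ s∈S , u , u∈T , trans eq (+-congʳ s≈s′))
    (λ s → (s ∈? S) ×-dec ∃?
      (λ u≈u′ (u∈T , eq) → ∈-resp T u≈u′ u∈T , trans eq (+-congˡ u≈u′))
      (λ u → (u ∈? T) ×-dec (z ≟ s +ᴿ u)))

  nonzeroPower? : ∀ k → Decidable (λ y → ∃[ x ] (x ≉ 0# × y ≈ x ^ᴿ k))
  nonzeroPower? k y = ∃?
    (λ x≈x′ (x≉0 , eq) → x≉0 ∘ trans x≈x′ , trans eq (^ᴿ-congˡ k x≈x′))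
    (λ x → ¬? (x ≟ 0#) ×-dec (y ≟ x ^ᴿ k))

  ∈⊝⁻ : ∀ S a {i} → i Sub.∈ S ⊝ a → (element i +ᴿ a) ∈ S
  ∈⊝⁻ S a {i} i∈ with ∈-comprehension⁻ (⊝? S a) i∈
  ... | x , x∈S , i≈x-a = ∈-resp S
    (trans (x-expand x a) (trans (+-comm a _) (+-congʳ (sym i≈x-a)))) x∈S

  ∈⊝⁺ : ∀ S a {i} → (element i +ᴿ a) ∈ S → i Sub.∈ S ⊝ a
  ∈⊝⁺ S a {i} i+a∈S = ∈-comprehension⁺ (⊝? S a) (element i +ᴿ a , i+a∈S , (begin
    element i               ≈⟨ +-identityʳ _ ⟨
    element i +ᴿ 0#         ≈⟨ +-congˡ (-‿inverseʳ a) ⟨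
    element i +ᴿ (a - a)    ≈⟨ +-assoc _ a _ ⟨
    element i +ᴿ a - a      ∎))

  ∈⊕⁻ : ∀ S T {i} → i Sub.∈ S ⊕ T →
        ∃[ j ] ∃[ l ] (j Sub.∈ S × l Sub.∈ T × element i ≈ element j +ᴿ element l)
  ∈⊕⁻ S T i∈ with ∈-comprehension⁻ (⊕? S T) i∈
  ... | s , s∈S , u , u∈T , i≈s+u = index s , index u , s∈S , u∈T ,
    trans i≈s+u (+-cong (sym (element-index s)) (sym (element-index u)))

  ∈⊕⁺ : ∀ S T {i j} → i Sub.∈ S → j Sub.∈ T → (element i +ᴿ element j) ∈ S ⊕ T
  ∈⊕⁺ S T {i} {j} i∈S j∈T = ∈-comprehension⁺ (⊕? S T)
    (element i , element∈ i∈S , element j , element∈ j∈T , element-index _)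
    where
    element∈ : ∀ {U i} → i Sub.∈ U → element i ∈ U
    element∈ {U} = ≡.subst (Sub._∈ U) (≡.sym (index-element _))

  -- The group of `k`-th powers and its decompositions.

  -- If `x = y ^ k`, then `x ^ t = y ^ (q - 1) = 1` by Fermat.
  x∈A⇒x^t≈1 : ∀ {k x} (k∣q-1 : k ∣ q ∸ 1) → x ∈ nonzeroPowers k → x ^ᴿ quotient k∣q-1 ≈ 1#
  x∈A⇒x^t≈1 {k} {x} (divides t q-1≡t*k) x∈A with ∈-comprehension⁻ (nonzeroPower? k) x∈A
  ... | y , y≉0 , x≈y^k = begin
    x ^ᴿ t             ≈⟨ ^ᴿ-congˡ t (trans (sym (element-index x)) x≈y^k) ⟩
    (y ^ᴿ k) ^ᴿ t      ≈⟨ ^-assocʳ y k t ⟩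
    y ^ᴿ (k * t)       ≡⟨ ≡.cong (y ^ᴿ_) (≡.trans (ℕ.*-comm k t) (≡.sym q-1≡t*k)) ⟩
    y ^ᴿ (q ∸ 1)       ≈⟨ x^[q-1]≈1 y≉0 ⟩
    1#                 ∎

  x≉0⇒x^k∈A : ∀ {x} k → x ≉ 0# → x ^ᴿ k ∈ nonzeroPowers k
  x≉0⇒x^k∈A {x} k x≉0 = ∈-comprehension⁺ (nonzeroPower? k) (x , x≉0 , element-index _)

  0<q-1 : 0 < q ∸ 1
  0<q-1 = distinct (index 0#) (index 1#) λ eq → 1≉0
    (trans (sym (element-index 1#)) (trans (reflexive (≡.cong element (≡.sym eq))) (element-index 0#)))
    where
    distinct : ∀ {n} (i j : Fin n) → i ≢ j → 0 < n ∸ 1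
    distinct {suc zero}    zero zero i≢j = contradiction ≡.refl i≢j
    distinct {suc (suc n)} i    j    i≢j = s≤s z≤n

  -- Every nonzero x is a k-th root of some s + u, and each s + u has at most k of them.
  A≡S⊕T⇒t≤∣S∣*∣T∣ : ∀ {k} (k∣q-1 : k ∣ q ∸ 1) S T → nonzeroPowers k ≡ S ⊕ T →
                    quotient k∣q-1 ≤ ∣ S ∣ * ∣ T ∣
  A≡S⊕T⇒t≤∣S∣*∣T∣ {zero} (divides t q-1≡t*0) _ _ _ =
    -- The field has two distinct elements, so `q ∸ 1` is positive and cannot be a multiple of 0.
    contradiction (≡.subst (0 <_) (≡.trans q-1≡t*0 (ℕ.*-zeroʳ t)) 0<q-1) λ ()
  A≡S⊕T⇒t≤∣S∣*∣T∣ {k@(suc _)} (divides t q-1≡t*k) S T A≡S⊕T =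
    -- Instead of computing the order of `A`, the inequality is multiplied by `k` and the `q - 1`
    -- nonzero elements are counted.
    ℕ.*-cancelʳ-≤ t (∣ S ∣ * ∣ T ∣) k (ℕR.begin
      t * k                          ℕR.≡⟨ q-1≡t*k ⟨
      q ∸ 1                          ℕR.≡⟨ ≡.cong (q ∸_) (Sub.∣⁅x⁆∣≡1 (index 0#)) ⟨
      q ∸ ∣ ⁅ index 0# ⁆ ∣           ℕR.≡⟨ Sub.∣∁p∣≡n∸∣p∣ ⁅ index 0# ⁆ ⟨
      ∣ ∁ ⁅ index 0# ⁆ ∣             ℕR.≤⟨ Sub.p⊆q⇒∣p∣≤∣q∣ nonzero⊆roots ⟩
      ∣ ⋃ S (λ j → ⋃ T (roots j)) ∣  ℕR.≤⟨ ∣⋃∣≤ S _ (λ j → ∣⋃∣≤ T (roots j) (∣roots∣≤k j)) ⟩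
      ∣ S ∣ * (∣ T ∣ * k)            ℕR.≡⟨ ℕ.*-assoc ∣ S ∣ ∣ T ∣ k ⟨
      ∣ S ∣ * ∣ T ∣ * k              ℕR.∎)
    where
    module ℕR = ℕ.≤-Reasoning
    root? : ∀ j l → Decidable (λ x → x ^ᴿ k ≈ element j +ᴿ element l)
    root? j l x = x ^ᴿ k ≟ element j +ᴿ element l
    roots : Fin q → Fin q → Subset q
    roots j l = comprehension _ (root? j l)
    ∣roots∣≤k : ∀ j l → ∣ roots j l ∣ ≤ k
    ∣roots∣≤k j l = ∣fibre∣≤degree (roots j l) (powerX k) 1≉0 (∈-comprehension⁻ (root? j l))
    nonzero⊆roots : ∁ ⁅ index 0# ⁆ Sub.⊆ ⋃ S (λ j → ⋃ T (roots j))
    nonzero⊆roots {i} i∈∁0 with ∈⊕⁻ S T (≡.subst (element i ^ᴿ k ∈_) A≡S⊕T (x≉0⇒x^k∈A k i≉0))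
      where
      i≉0 : element i ≉ 0#
      i≉0 i≈0 = Sub.x∈∁p⇒x∉p i∈∁0 (≡.subst (Sub._∈ ⁅ index 0# ⁆)
        (element-injective (trans (element-index 0#) (sym i≈0))) (Sub.x∈⁅x⁆ (index 0#)))
    ... | j , l , j∈S , l∈T , i^k≈j+l = x∈⋃⁺ j∈S (x∈⋃⁺ l∈T
      (∈-comprehension⁺ (root? j l) (trans (sym (element-index _)) i^k≈j+l)))

  -- Translates and decompositions of a set of `t`-th roots of unity.

  module RootsOfUnity {p f t} (p-prime : Prime p) (q≡p^f : q ≡ p ^ f)
    (A : Subset q) (x^t≈1 : ∀ {x} → x ∈ A → x ^ᴿ t ≈ 1#)
    (e : ℕ) (r : ℤ) (p^e≡r : ℤ.+ (p ^ e) ≡ r [mod t ]) (r≢1 : r ≢ 1ℤ)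
    (p∤r : ¬ (ℤ.+ p ℤ.∣ r)) where
    open PositiveCharacteristic p-prime (q≡p^f⇒p×1≈0 {p} {f} q≡p^f)

    -- `r` and its hypotheses are quantified again so that matching on `r` selects the formula for
    -- `M`. The junk values are never reached: `p` divides 0, and `r = 1` is excluded outright.
    ∣S∣≤M : ∀ r → ℤ.+ (p ^ e) ≡ r [mod t ] → r ≢ 1ℤ → ¬ (ℤ.+ p ℤ.∣ r) →
            ∀ {a d} (S : Subset q) → d ≉ 0# →
            (∀ {i} → i Sub.∈ S → (element i +ᴿ a) ∈ A × (element i +ᴿ a +ᴿ d) ∈ A) → ∣ S ∣ ≤ M r
    ∣S∣≤M (ℤ.+ 0) _ _ p∤0 S d≉0 S+a∈A = contradiction (divides 0 ≡.refl) p∤0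
    ∣S∣≤M (ℤ.+ 1) _ 1≢1 _ S d≉0 S+a∈A = contradiction ≡.refl 1≢1
    ∣S∣≤M (ℤ.+ suc (suc n)) p^e≡r _ p∤r S d≉0 S+a∈A = ∣S∣≤1+n e _ _ S d≉0 p∤r λ i∈S →
      Product.map power power (S+a∈A i∈S)
      where
      power : ∀ {x} → x ∈ A → x ^ᴿ (p ^ e) ≈ x ^ᴿ (2 + n)
      power x∈A = m≡n[t]⇒x^m≈x^n (p ^ e) (2 + n) (x^t≈1 x∈A) p^e≡r
    ∣S∣≤M -[1+ n ] p^e≡r _ _ S d≉0 S+a∈A = ∣S∣≤2*[1+n] e _ _ S d≉0 λ i∈S →
      Product.map power power (S+a∈A i∈S)
      where
      power : ∀ {x} → x ∈ A → x ^ᴿ (p ^ e) *ᴿ x ^ᴿ suc n ≈ 1#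
      power x∈A = m≡-n[t]⇒x^m*x^n≈1 (p ^ e) n (x^t≈1 x∈A) p^e≡r

    -- For `y` in both translates, `x = y + a` and `x + d = y + b` lie in `A`, where `d = b - a` is
    -- nonzero.
    ∣[A-a]∩[A-b]∣≤M : ∀ a b → a ≉ b → ∣ (A ⊝ a) ∩ (A ⊝ b) ∣ ≤ M r
    ∣[A-a]∩[A-b]∣≤M a b a≉b = ∣S∣≤M r p^e≡r r≢1 p∤r ((A ⊝ a) ∩ (A ⊝ b))
      (λ b-a≈0 → a≉b (sym (x∙y⁻¹≈ε⇒x≈y b a b-a≈0)))
      λ {i} i∈ → let i∈A-a , i∈A-b = Sub.x∈p∩q⁻ (A ⊝ a) (A ⊝ b) i∈ in
        ∈⊝⁻ A a i∈A-a ,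
        ∈-resp A (trans (+-congˡ (x-expand b a)) (sym (+-assoc _ a _))) (∈⊝⁻ A b i∈A-b)

    -- Assuming the inclusion elementwise lets commutativity of addition exchange the roles of `S`
    -- and `T`.
    S+T⊆A⇒∣S∣≤M : ∀ {S T} → 2 ≤ ∣ T ∣ →
                  (∀ {i j} → i Sub.∈ S → j Sub.∈ T → (element i +ᴿ element j) ∈ A) → ∣ S ∣ ≤ M r
    S+T⊆A⇒∣S∣≤M {S} {T} 2≤∣T∣ S+T⊆A with 2≤∣p∣⇒∃≢ T 2≤∣T∣
    ... | j , l , j∈T , l∈T , j≢l = ℕ.≤-trans
      (Sub.p⊆q⇒∣p∣≤∣q∣ {p = S} {q = (A ⊝ element j) ∩ (A ⊝ element l)} λ i∈S → Sub.x∈p∩q⁺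
        (∈⊝⁺ A (element j) (S+T⊆A i∈S j∈T) , ∈⊝⁺ A (element l) (S+T⊆A i∈S l∈T)))
      (∣[A-a]∩[A-b]∣≤M (element j) (element l) (j≢l ∘ element-injective))

    A≡S⊕T⇒∣S∣,∣T∣≤M : ∀ S T → 2 ≤ ∣ S ∣ → 2 ≤ ∣ T ∣ → A ≡ S ⊕ T → ∣ S ∣ ≤ M r × ∣ T ∣ ≤ M r
    A≡S⊕T⇒∣S∣,∣T∣≤M S T 2≤∣S∣ 2≤∣T∣ A≡S⊕T =
      S+T⊆A⇒∣S∣≤M 2≤∣T∣ S+T⊆A ,
      S+T⊆A⇒∣S∣≤M 2≤∣S∣ (λ j∈T i∈S → ∈-resp A (+-comm _ _) (S+T⊆A i∈S j∈T))
      where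
      S+T⊆A : ∀ {i j} → i Sub.∈ S → j Sub.∈ T → (element i +ᴿ element j) ∈ A
      S+T⊆A {i} {j} i∈S j∈T =
        ≡.subst ((element i +ᴿ element j) ∈_) (≡.sym A≡S⊕T) (∈⊕⁺ S T i∈S j∈T)

    -- A decomposition would give `t ≤ ∣ S ∣ * ∣ T ∣ ≤ M r * M r`.
    M²<t⇒irreducible : (∀ S T → A ≡ S ⊕ T → t ≤ ∣ S ∣ * ∣ T ∣) →
                       M r ^ 2 < t → AdditivelyIrreducible A
    M²<t⇒irreducible t≤∣S∣*∣T∣ M²<t (S , T , 2≤∣S∣ , 2≤∣T∣ , A≡S⊕T) =
      let ∣S∣≤M , ∣T∣≤M = A≡S⊕T⇒∣S∣,∣T∣≤M S T 2≤∣S∣ 2≤∣T∣ A≡S⊕T in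
      ℕ.<⇒≱ M²<t (ℕ.≤-trans (t≤∣S∣*∣T∣ S T A≡S⊕T)
        -- `M r ^ 2` unfolds to `M r * (M r * 1)`.
        (≡.subst (∣ S ∣ * ∣ T ∣ ≤_) (≡.cong (M r *_) (≡.sym (ℕ.*-identityʳ (M r))))
          (ℕ.*-mono-≤ ∣S∣≤M ∣T∣≤M)))

open import Data.Integer using (+_)

theorem1p5 : ∀ {c ℓ₁ ℓ₂} (p f q : ℕ) → Prime p → 1 ≤ f → q ≡ p ^ f →
  (F : FiniteField c ℓ₁ ℓ₂ q) →
  let open FiniteField F hiding (_^_)
      open FieldSubsets F in
  (k : ℕ) (k∣q-1 : k ∣ q ∸ 1) →
  let A = nonzeroPowers k
      t = quotient k∣q-1 in
  1 < t →
  (e : ℕ) (r : ℤ) → 1 ≤ e → + (p ^ e) ≡ r [mod t ] → r ≢ 1ℤ → ¬ (+ p ℤ.∣ r) →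
  ((a b : Carrier) → a ≉ b → ∣ (A ⊝ a) ∩ (A ⊝ b) ∣ ≤ M r) ×
  ((S T : Subset q) → 2 ≤ ∣ S ∣ → 2 ≤ ∣ T ∣ → A ≡ S ⊕ T → ∣ S ∣ ≤ M r × ∣ T ∣ ≤ M r) ×
  (M r ^ 2 < t → AdditivelyIrreducible A)
theorem1p5 p f q p-prime 1≤f q≡p^f F k k∣q-1 1<t e r 1≤e p^e≡r r≢1 p∤r =
  ∣[A-a]∩[A-b]∣≤M , A≡S⊕T⇒∣S∣,∣T∣≤M , M²<t⇒irreducible (A≡S⊕T⇒t≤∣S∣*∣T∣ k∣q-1)
  where
  open FieldSubsets F using (nonzeroPowers)
  open FiniteFieldProperties F using (x∈A⇒x^t≈1; A≡S⊕T⇒t≤∣S∣*∣T∣; module RootsOfUnity)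
  open RootsOfUnity {f = f} p-prime q≡p^f (nonzeroPowers k) (x∈A⇒x^t≈1 k∣q-1) e r p^e≡r r≢1 p∤r
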